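{- Let $X$ be a face-transitive surface. Then the vertex-face type $\mathrm{vf}(X)$ of $X$ satisfies $$\mathrm{vf}(X)\in\{(3,1),(2,1),(2,2),(1,1),(1,2),(1,3),(1,6)\}.$$
   Context: A simplicial complex $X$ on a finite non-empty set $P$ is a non-empty family of subsets of $P$ closed under taking subsets; $X_i$ denotes the set of its elements of cardinality $i+1$; elements of $X_0,X_1,X_2$ are vertices, edges, faces. A simplicial surface is a simplicial complex $X$ such that: all inclusion-maximal elements have cardinality $3$; every edge is contained in exactly two faces; and for every vertex $v$ the faces containing $v$ can be arranged in a cyclic sequence $(F_1,\dots,F_n)$ (each occurring once) with $|F_i\cap F_{i+1}|=2$ for all $i$ (subscripts modulo $n$). All simplicial surfaces are assumed strongly connected (any two faces are joined by a sequence of faces in which consecutive faces share an edge). $\mathrm{Aut}(X)$ is the group of automorphisms of $X$ (equivalently, permutations of $X_0$ mapping faces to faces). $X$ is face-transitive if $\mathrm{Aut}(X)$ acts transitively on $X_2$. For a face-transitive surface $X$, the vertex-face type is $\mathrm{vf}(X)=(a,s)$, where $a$ is the number of orbits of $\mathrm{Aut}(X)$ on $X_0$ and $s=|\mathrm{stab}_{\mathrm{Aut}(X)}(F)|$ is the order of the (setwise) stabiliser of a face $F\in X_2$ (independent of $F$). -}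

module Defs where

open import Data.Bool.Base using (Bool; T; if_then_else_)
import Data.Bool.Properties as Bool
open import Data.Bool.Properties using (T-irrelevant)
open import Data.Fin.Base using (Fin; toℕ)
import Data.Fin.Properties as Fin
open import Data.Fin.Subset
  using (Subset; ⁅_⁆; ∣_∣; _∩_; _⊆_) renaming (_∈_ to _∈ˢ_)
open import Data.Fin.Subset.Properties using (anySubset?) renaming (_∈?_ to _∈ˢ?_)
open import Data.List.Base as List
  using (List; []; _∷_; allFin; cartesianProduct; cartesianProductWith;
         concatMap; deduplicate; length)
open import Data.List.Membership.Propositional using (_∈_; lose)
open import Data.List.Membership.Propositional.Properties
  using (∈-allFin; ∈-concatMap⁺; ∈-map⁺)
open import Data.List.Relation.Unary.All as All using ()
open import Data.List.Relation.Unary.Any as Any using (Any; here; there; any?; satisfied)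
open import Data.List.Relation.Unary.Any.Properties
  using (cartesianProduct⁺; cartesianProductWith⁺; concatMap⁺; map⁺)
open import Data.List.Relation.Unary.Enumerates.Setoid using (IsEnumeration)
open import Data.Nat.Base using (ℕ; suc; NonZero)
open import Data.Nat.DivMod using (_%_)
import Data.Nat.Properties as ℕ
open import Data.Product.Base using (Σ; ∃; ∃₂; _×_; _,_; proj₁)
open import Data.Product.Properties using () renaming (≡-dec to Σ-≡-dec)
open import Data.Sum.Base using (_⊎_)
open import Data.Vec.Base using (tabulate)
import Data.Vec.Properties as Vec
open import Function.Base using (id)
open import Function.Bundles using (Inverse; _↔_; mk⇔; mk↔ₛ′)
open import Function.Definitions using (Injective; StrictlyInverseˡ; StrictlyInverseʳ)
open import Level using (Level; 0ℓ)
open import Relation.Binary.Bundles using (DecSetoid)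
import Relation.Binary.Construct.On as On
open import Relation.Binary.Construct.Closure.ReflexiveTransitive using (Star)
open import Relation.Binary.Definitions using (DecidableEquality)
open import Relation.Binary.PropositionalEquality
  using (_≡_; _≢_; refl; sym; trans; cong; subst)
open import Relation.Binary.PropositionalEquality.Properties using (decSetoid)
open import Relation.Nullary.Decidable.Core
  using (Dec; yes; no; does; T?; ¬?; _×-dec_; _→-dec_; map′; decidable-stable)
open import Relation.Nullary.Decidable using (does-⇔)
open import Relation.Nullary.Negation.Core using (contradiction)
open import Relation.Unary using (Pred; Decidable)

private
  variable
    a p ℓ : Level
    A : Set a
    n : ℕ

-- The number of equivalence classes of a decidable setoid with a given finite
-- enumeration; it does not depend on the enumeration.
card : (S : DecSetoid a ℓ) {xs : List (DecSetoid.Carrier S)} →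
       IsEnumeration (DecSetoid.setoid S) xs → ℕ
card S {xs} _ = length (deduplicate (DecSetoid._≟_ S) xs)

comprehension : {P : Pred (Fin n) p} → Decidable P → Subset n
comprehension P? = tabulate (λ w → does (P? w))

_≟ˢ_ : DecidableEquality (Subset n)
_≟ˢ_ = Vec.≡-dec Bool._≟_

allSubset? : {P : Pred (Subset n) p} → Decidable P → Dec (∀ σ → P σ)
allSubset? P? = map′
  (λ ∄ σ → decidable-stable (P? σ) (λ ¬Pσ → ∄ (σ , ¬Pσ)))
  (λ ∀P (σ , ¬Pσ) → ¬Pσ (∀P σ))
  (¬? (anySubset? (λ σ → ¬? (P? σ))))

fromDec : Dec A → List A
fromDec (yes x) = x ∷ []
fromDec (no _)  = []

fromDec-any : {P : Pred A p} (A? : Dec A) → A → (∀ x → P x) → Any P (fromDec A?)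
fromDec-any (yes x) _ ∀P = here (∀P x)
fromDec-any (no ¬x) x _  = contradiction x ¬x

-- All self-maps of a finite type, up to pointwise equality.
module Functions (_≟_ : DecidableEquality A) (xs : List A) (complete : ∀ x → x ∈ xs) where

  update : A → A → (A → A) → A → A
  update y z f x = if does (x ≟ y) then z else f x

  update-agrees : ∀ (g f : A → A) {y z x} → z ≡ g y → (x ≢ y → f x ≡ g x) →
                  update y z f x ≡ g x
  update-agrees g f {y} {x = x} z≡ f≡ with x ≟ y
  ... | yes refl = z≡
  ... | no x≢y   = f≡ x≢y

  functionsOn : List A → List (A → A)
  functionsOn []       = id ∷ []
  functionsOn (y ∷ ys) = cartesianProductWith (update y) xs (functionsOn ys)

  functionsOn-complete : ∀ ys (g : A → A) →
    Any (λ f → ∀ {x} → x ∈ ys → f x ≡ g x) (functionsOn ys)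
  functionsOn-complete []       g = here λ ()
  functionsOn-complete (y ∷ ys) g =
    cartesianProductWith⁺ (update y)
      (λ {_} {f} z≡ f≡ → λ where
        (here refl) → update-agrees g f (sym z≡) (contradiction refl)
        (there x∈)  → update-agrees g f (sym z≡) (λ _ → f≡ x∈))
      (complete (g y)) (functionsOn-complete ys g)

  functions : List (A → A)
  functions = functionsOn xs

  functions-complete : ∀ g → Any (λ f → ∀ x → f x ≡ g x) functions
  functions-complete g = Any.map (λ f≡ x → f≡ (complete x)) (functionsOn-complete xs g)

-- The ground set P is Fin n; a family of subsets of P is given by its
-- characteristic function.
record SimplicialComplex (n : ℕ) : Set where
  field
    ground-nonEmpty : NonZero n
    family          : Subset n → Bool

  IsSimplex : Subset n → Set
  IsSimplex σ = T (family σ)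

  field
    nonEmpty   : ∃ IsSimplex
    downClosed : ∀ {σ τ} → σ ⊆ τ → IsSimplex τ → IsSimplex σ

  IsSimplexOfDim : ℕ → Subset n → Set
  IsSimplexOfDim i σ = IsSimplex σ × ∣ σ ∣ ≡ suc i

  IsEdge IsFace : Subset n → Set
  IsEdge = IsSimplexOfDim 1
  IsFace = IsSimplexOfDim 2

  Face : Set
  Face = ∃ IsFace

  -- The vertex {v} is represented by the point v; not every point of P need be
  -- a vertex.
  Vertex : Set
  Vertex = Σ (Fin n) λ v → IsSimplex ⁅ v ⁆

  point : Vertex → Fin n
  point = proj₁

  IsMaximal : Subset n → Set
  IsMaximal σ = IsSimplex σ × (∀ {τ} → IsSimplex τ → σ ⊆ τ → τ ≡ σ)

  -- A cyclic arrangement (F₀, …, Fₖ) of the faces containing v.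
  record Umbrella (v : Vertex) : Set where
    field
      k           : ℕ
      F           : Fin (suc k) → Subset n
      F-injective : Injective _≡_ _≡_ F
      F-face      : ∀ i → IsFace (F i) × point v ∈ˢ F i
      F-onto      : ∀ {G} → IsFace G → point v ∈ˢ G → ∃ λ i → F i ≡ G
      consecutive : ∀ i j → toℕ j ≡ suc (toℕ i) % suc k → ∣ F i ∩ F j ∣ ≡ 2

  InExactlyTwoFaces : Subset n → Set
  InExactlyTwoFaces e = ∃₂ λ F G → F ≢ G ×
    (IsFace F × e ⊆ F) × (IsFace G × e ⊆ G) ×
    (∀ {H} → IsFace H → e ⊆ H → H ≡ F ⊎ H ≡ G)

  ShareEdge : Face → Face → Set
  ShareEdge (F , _) (G , _) = ∃ λ e → IsEdge e × e ⊆ F × e ⊆ G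

  StronglyConnected : Set
  StronglyConnected = ∀ F G → Star ShareEdge F G

record SimplicialSurface (n : ℕ) : Set where
  field
    complex : SimplicialComplex n
  open SimplicialComplex complex public
  field
    maximal⇒triangle  : ∀ {σ} → IsMaximal σ → ∣ σ ∣ ≡ 3
    edge-in-two-faces : ∀ {e} → IsEdge e → InExactlyTwoFaces e
    umbrella          : ∀ v → Umbrella v
    connected         : StronglyConnected

module _ (X : SimplicialSurface n) where
  open SimplicialSurface X

  infix 4 _≟ᵛ_
  _≟ᵛ_ : DecidableEquality Vertex
  _≟ᵛ_ = Σ-≡-dec Fin._≟_ (λ p q → yes (T-irrelevant p q))

  vertices : List Vertex
  vertices = concatMap (λ v → List.map (v ,_) (fromDec (T? (family ⁅ v ⁆)))) (allFin n)

  ∈-vertices : ∀ v → v ∈ vertices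
  ∈-vertices (v , vertex) =
    ∈-concatMap⁺ _ (lose (∈-allFin v) (∈-map⁺ (v ,_) (fromDec-any (T? _) vertex (T-irrelevant vertex))))

  ∃Vertex? : {P : Pred Vertex p} → Decidable P → Dec (∃ P)
  ∃Vertex? P? = map′ satisfied (λ (v , Pv) → lose (∈-vertices v) Pv) (any? P? vertices)

  ∀Vertex? : {P : Pred Vertex p} → Decidable P → Dec (∀ v → P v)
  ∀Vertex? P? = map′ (λ ∀P v → All.lookup ∀P (∈-vertices v))
                     (λ ∀P → All.tabulate (λ {v} _ → ∀P v))
                     (All.all? P? vertices)

  image : (Vertex → Vertex) → Subset n → Subset n
  image g F = comprehension λ w →
    ∃Vertex? λ v → (point v ∈ˢ? F) ×-dec (point (g v) Fin.≟ w)

  MapsFaces : (Vertex → Vertex) → Set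
  MapsFaces g = ∀ F → IsFace F → IsFace (image g F)

  record Automorphism : Set where
    constructor automorphism
    field
      permutation : Vertex ↔ Vertex
      mapsFaces   : MapsFaces (Inverse.to permutation)

    apply : Vertex → Vertex
    apply = Inverse.to permutation

  open Automorphism public using (apply)

  FaceTransitive : Set
  FaceTransitive = ∀ F G → IsFace F → IsFace G → ∃ λ g → image (apply g) F ≡ G

  Stabiliser : Subset n → Set
  Stabiliser F = ∃ λ g → image (apply g) F ≡ F

  -- Elements of the stabiliser are compared as maps on the vertices; the
  -- proofs they carry are disregarded.
  stabiliser : Subset n → DecSetoid 0ℓ 0ℓ
  stabiliser F = record
    { Carrier          = Stabiliser F
    ; _≈_              = λ (g , _) (h , _) → ∀ v → apply g v ≡ apply h v
    ; isDecEquivalence = record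
      { isEquivalence = record
        { refl  = λ _ → refl
        ; sym   = λ g≈h v → sym (g≈h v)
        ; trans = λ f≈g g≈h v → trans (f≈g v) (g≈h v)
        }
      ; _≟_ = λ (g , _) (h , _) → ∀Vertex? λ v → apply g v ≟ᵛ apply h v
      }
    }

  image-cong : ∀ {g h} → (∀ v → g v ≡ h v) → ∀ F → image g F ≡ image h F
  image-cong {g} {h} g≗h F = Vec.tabulate-cong λ w → does-⇔
    (mk⇔ (λ (v , v∈F , gv≡w) → v , v∈F , trans (cong point (sym (g≗h v))) gv≡w)
         (λ (v , v∈F , hv≡w) → v , v∈F , trans (cong point (g≗h v)) hv≡w))
    (∃Vertex? _) (∃Vertex? _)

  open Functions _≟ᵛ_ vertices ∈-vertices using (functions; functions-complete)

  IsAutomorphism : (Vertex → Vertex) × (Vertex → Vertex) → Set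
  IsAutomorphism (g , g⁻¹) =
    StrictlyInverseˡ _≡_ g g⁻¹ × StrictlyInverseʳ _≡_ g g⁻¹ × MapsFaces g

  isAutomorphism? : Decidable IsAutomorphism
  isAutomorphism? (g , g⁻¹) =
    ∀Vertex? (λ v → g (g⁻¹ v) ≟ᵛ v) ×-dec
    ∀Vertex? (λ v → g⁻¹ (g v) ≟ᵛ v) ×-dec
    allSubset? (λ F → isFace? F →-dec isFace? (image g F))
    where
    isFace? : Decidable IsFace
    isFace? F = T? (family F) ×-dec (∣ F ∣ ℕ.≟ 3)

  toAutomorphism : ∀ {gg⁻¹} → IsAutomorphism gg⁻¹ → Automorphism
  toAutomorphism {g , g⁻¹} (invˡ , invʳ , maps) = automorphism (mk↔ₛ′ g g⁻¹ invˡ invʳ) maps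

  automorphisms : List Automorphism
  automorphisms = concatMap
    (λ gg⁻¹ → List.map toAutomorphism (fromDec (isAutomorphism? gg⁻¹)))
    (cartesianProduct functions functions)

  automorphisms-complete : ∀ g → Any (λ h → ∀ v → apply g v ≡ apply h v) automorphisms
  automorphisms-complete g =
    concatMap⁺ _ (Any.map
      (λ {gg⁻¹} (f≗ , f⁻¹≗) → map⁺ (fromDec-any (isAutomorphism? gg⁻¹)
        (isAut f≗ f⁻¹≗) (λ _ v → sym (f≗ v))))
      (cartesianProduct⁺ (functions-complete to) (functions-complete from)))
    where
    open Automorphism g
    open Inverse permutation using (to; from; strictlyInverseˡ; strictlyInverseʳ)

    isAut : ∀ {f f⁻¹} → (∀ v → f v ≡ to v) → (∀ v → f⁻¹ v ≡ from v) → IsAutomorphism (f , f⁻¹)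
    isAut f≗ f⁻¹≗ =
      (λ v → trans (f≗ _) (trans (cong to (f⁻¹≗ v)) (strictlyInverseˡ v))) ,
      (λ v → trans (f⁻¹≗ _) (trans (cong from (f≗ v)) (strictlyInverseʳ v))) ,
      (λ F face → subst IsFace (sym (image-cong f≗ F)) (mapsFaces F face))

  stabiliserElements : (F : Subset n) → List (Stabiliser F)
  stabiliserElements F =
    concatMap (λ g → List.map (g ,_) (fromDec (image (apply g) F ≟ˢ F))) automorphisms

  stabiliserElements-complete :
    ∀ F → IsEnumeration (DecSetoid.setoid (stabiliser F)) (stabiliserElements F)
  stabiliserElements-complete F (g , gF≡F) =
    concatMap⁺ _ (Any.map
      (λ {h} g≗h → map⁺ (fromDec-any (image (apply h) F ≟ˢ F)
        (trans (sym (image-cong g≗h F)) gF≡F) (λ _ → g≗h)))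
      (automorphisms-complete g))

  -- { g v | g ∈ Aut(X) }
  orbit : Vertex → Subset n
  orbit v = comprehension λ w → ∃Automorphism? w
    where
    ∃Automorphism? : ∀ w → Dec (∃ λ g → point (apply g v) ≡ w)
    ∃Automorphism? w = map′ satisfied
      (λ (g , gv≡w) → Any.map (λ g≗h → trans (cong point (sym (g≗h v))) gv≡w)
                              (automorphisms-complete g))
      (any? (λ g → point (apply g v) Fin.≟ w) automorphisms)

  -- Two vertices are identified when their orbits are equal, so the
  -- equivalence classes correspond to the orbits.
  orbits : DecSetoid 0ℓ 0ℓ
  orbits = On.decSetoid (decSetoid _≟ˢ_) orbit

  vertices-complete : IsEnumeration (DecSetoid.setoid orbits) vertices
  vertices-complete v = Any.map (cong orbit) (∈-vertices v)

  -- The vertex-face type, with the stabiliser order computed at the face F;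
  -- for a face-transitive X it does not depend on F.
  vf : Subset n → ℕ × ℕ
  vf F = card orbits vertices-complete , card (stabiliser F) (stabiliserElements-complete F)

{-# OPTIONS --safe #-}
module Submission where

-- Two automorphisms that agree on a face agree on each neighbouring face, because the
-- edge in common lies in only two faces; by strong connectedness they agree everywhere.
-- Hence the stabiliser of a face F embeds in the symmetric group on the corners of F.
-- By face-transitivity every orbit on the vertices contains a corner of F, so the type
-- is determined by a subgroup of S₃ and a colouring of the three corners that this
-- subgroup preserves. These are finitely many, and they are checked by evaluation.

open import Defs
open import Data.Bool.Properties using (T-irrelevant)
open import Data.Fin.Base as Fin using (Fin; zero; suc)
open import Data.Fin.Patterns using (0F; 1F; 2F)
open import Data.Fin.Properties as Fin using (all?; any?)
open import Data.Fin.Subset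
  using (Subset; inside; outside; ⁅_⁆; ∣_∣; _∪_; _⊆_; _⊂_)
  renaming (_∈_ to _∈ˢ_; _∉_ to _∉ˢ_)
open import Data.Fin.Subset.Properties
  using (⊆-antisym; p⊂q⇒∣p∣<∣q∣; p⊆p∪q; x∈p∪q⁺; x∈p∪q⁻; x∈⁅x⁆; x∈⁅y⁆⇒x≡y)
  renaming (_∈?_ to _∈ˢ?_)
open import Data.List.Base as List using (List; _∷_; []; deduplicate; filter; length; map)
import Data.List.Membership.DecPropositional as DecMembership
open import Data.List.Membership.Propositional using (_∈_)
open import Data.List.Membership.Propositional.Properties
  using (∈-map⁺; ∈-map⁻; ∈-filter⁺; ∈-filter⁻; ∈-lookup; ∈-deduplicate⁺)
open import Data.List.Membership.Propositional.Properties.WithK using (unique∧set⇒bag)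
import Data.List.Membership.Setoid.Properties as SetoidMembership
open import Data.List.Properties using (length-map)
open import Data.List.Relation.Binary.BagAndSetEquality using (∼bag⇒↭; _∼[_]_; set)
open import Data.List.Relation.Binary.Permutation.Propositional.Properties using (↭-length)
open import Data.List.Relation.Unary.All as All using ()
import Data.List.Relation.Unary.All.Properties as All
open import Data.List.Relation.Unary.AllPairs using ([]; _∷_)
open import Data.List.Relation.Unary.Any as Any using (Any; here; there)
open import Data.List.Relation.Unary.Any.Properties using (lookup-index; map⁺)
open import Data.List.Relation.Unary.Enumerates.Setoid using (IsEnumeration)
import Data.List.Relation.Unary.Unique.DecPropositional.Properties as DecUnique
import Data.List.Relation.Unary.Unique.DecSetoid.Properties as DecSetoidUnique
open import Data.List.Relation.Unary.Unique.Propositional using (Unique)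
import Data.List.Relation.Unary.Unique.Propositional.Properties as Unique
import Data.List.Relation.Unary.Unique.Setoid.Properties as SetoidUnique
open import Data.Nat.Base using (ℕ; suc; s≤s; _<_)
import Data.Nat.Properties as ℕ
open import Data.Product.Base using (∃; _×_; _,_; proj₁; proj₂)
open import Data.Product.Properties using () renaming (≡-dec to ×-≡-dec)
open import Data.Sum.Base using (_⊎_; inj₁; inj₂)
open import Data.Vec.Base as Vec using (Vec; []; _∷_; here; there)
open import Data.Vec.Properties using (lookup∘tabulate; lookup⇒[]=; []=⇒lookup)
open import Function.Base using (_∘_; id)
open import Function.Bundles using (Inverse; Equivalence; _⇔_; mk⇔)
open import Function.Construct.Composition using (_↔-∘_)
open import Function.Construct.Identity using (↔-id)
open import Level using (Level)
open import Relation.Binary.Bundles using (DecSetoid)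
open import Relation.Binary.Construct.Closure.ReflexiveTransitive using (Star; ε; _◅_)
open import Relation.Binary.Definitions using (DecidableEquality)
open import Relation.Binary.PropositionalEquality as ≡
  using (_≡_; _≢_; refl; sym; trans; cong; subst; subst₂)
open import Relation.Nullary.Decidable
  using (Dec; yes; no; does; map′; dec-true; from-yes; ¬?; _→-dec_; _×-dec_)
open import Relation.Nullary.Negation using (¬_; contradiction)
open import Relation.Unary using (Pred; Decidable)

private
  variable
    a p ℓ : Level
    A : Set a
    n : ℕ

-- The symmetric group on three letters and its invariant colourings.

-- Rows are value tables: the identity, the two 3-cycles, then the three transpositions. An explicit
-- table lets every fact about the group be settled by evaluation.
symmetries : Vec (Vec (Fin 3) 3) 6
symmetries = (0F ∷ 1F ∷ 2F ∷ []) ∷ (1F ∷ 2F ∷ 0F ∷ []) ∷ (2F ∷ 0F ∷ 1F ∷ [])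
           ∷ (1F ∷ 0F ∷ 2F ∷ []) ∷ (2F ∷ 1F ∷ 0F ∷ []) ∷ (0F ∷ 2F ∷ 1F ∷ []) ∷ []

perm : Fin 6 → Fin 3 → Fin 3
perm = Vec.lookup ∘ Vec.lookup symmetries

perm-identity : ∀ k → perm zero k ≡ k
perm-identity = from-yes (all? λ k → perm zero k Fin.≟ k)

perm-faithful : ∀ i j → (∀ k → perm i k ≡ perm j k) → i ≡ j
perm-faithful = from-yes (all? λ i → all? λ j →
  (all? λ k → perm i k Fin.≟ perm j k) →-dec (i Fin.≟ j))

-- This is how an injective self-map of the corners, known only by its three values, receives an
-- index in the table.
perm-onto : ∀ a b c → a ≢ b → a ≢ c → b ≢ c →
            ∃ λ i → ∀ k → perm i k ≡ Vec.lookup (a ∷ b ∷ c ∷ []) k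
perm-onto = from-yes (all? λ a → all? λ b → all? λ c →
  ¬? (a Fin.≟ b) →-dec (¬? (a Fin.≟ c) →-dec (¬? (b Fin.≟ c) →-dec
    any? λ i → all? λ k → perm i k Fin.≟ Vec.lookup (a ∷ b ∷ c ∷ []) k)))

-- The exponent of S₃ is 6, so a fifth power serves as an inverse.
perm-order : ∀ i k → let p = perm i in p (p (p (p (p (p k))))) ≡ k
perm-order = from-yes (all? λ i → all? λ k →
  let p = perm i in p (p (p (p (p (p k))))) Fin.≟ k)

-- A submonoid of a finite group is a subgroup, so inverses need not be mentioned.
IsSubmonoid : Subset 6 → Set
IsSubmonoid A = zero ∈ˢ A ×
  (∀ i → i ∈ˢ A → ∀ j → j ∈ˢ A → ∀ l → (∀ k → perm l k ≡ perm i (perm j k)) → l ∈ˢ A)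

isSubmonoid? : ∀ A → Dec (IsSubmonoid A)
isSubmonoid? A = (zero ∈ˢ? A) ×-dec
  (all? λ i → (i ∈ˢ? A) →-dec (all? λ j → (j ∈ˢ? A) →-dec (all? λ l →
    (all? λ k → perm l k Fin.≟ perm i (perm j k)) →-dec (l ∈ˢ? A))))

-- The colouring may be coarser than the orbits of `A` on the corners: an automorphism that moves
-- the face can identify corners that its stabiliser does not.
IsInvariant : Subset 6 → Vec (Fin 3) 3 → Set
IsInvariant A c = ∀ i → i ∈ˢ A → ∀ k → Vec.lookup c (perm i k) ≡ Vec.lookup c k

isInvariant? : ∀ A c → Dec (IsInvariant A c)
isInvariant? A c = all? λ i → (i ∈ˢ? A) →-dec
  (all? λ k → Vec.lookup c (perm i k) Fin.≟ Vec.lookup c k)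

types : List (ℕ × ℕ)
types = (3 , 1) ∷ (2 , 1) ∷ (2 , 2) ∷ (1 , 1) ∷ (1 , 2) ∷ (1 , 3) ∷ (1 , 6) ∷ []

range : ∀ {m l : ℕ} → Vec (Fin m) l → Subset m
range c = comprehension λ t → any? λ k → Vec.lookup c k Fin.≟ t

-- Three colours force the trivial group; exactly two leave at most the swap of the two corners of
-- equal colour; one colour allows every subgroup, of order 1, 2, 3 or 6. All 64 subsets and 27
-- colourings are tried.
triangle-types : ∀ A → IsSubmonoid A → ∀ c → IsInvariant A c → (∣ range c ∣ , ∣ A ∣) ∈ types
triangle-types A A-submonoid (x ∷ y ∷ z ∷ []) = from-yes
  (allSubset? λ A → isSubmonoid? A →-dec
    (all? λ x → all? λ y → all? λ z → isInvariant? A (x ∷ y ∷ z ∷ []) →-dec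
      ((∣ range (x ∷ y ∷ z ∷ []) ∣ , ∣ A ∣) ∈? types))) A A-submonoid x y z
  where open DecMembership (×-≡-dec ℕ._≟_ ℕ._≟_) using (_∈?_)

-- Cardinalities as lengths of lists without repetition.

unique-set-length : ∀ {xs ys : List A} → Unique xs → Unique ys → xs ∼[ set ] ys → length xs ≡ length ys
unique-set-length xs! ys! xs∼ys = ↭-length (∼bag⇒↭ (unique∧set⇒bag xs! ys! xs∼ys))

-- A complete invariant `f` turns equivalence into equality, so the deduplicated representatives map
-- to a repetition-free list with the same members as `ys`.
card-invariant : (S : DecSetoid a ℓ) → let open DecSetoid S in
  ∀ {B : Set p} {xs} (E : IsEnumeration setoid xs) (f : Carrier → B) →
  (∀ {x y} → x ≈ y → f x ≡ f y) → (∀ {x y} → f x ≡ f y → x ≈ y) →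
  ∀ {ys} → Unique ys → (∀ {t} → t ∈ ys ⇔ ∃ λ x → f x ≡ t) → card S E ≡ length ys
card-invariant S {xs = xs} E f cong-f inj ys! ys-values = trans (sym (length-map f (deduplicate _≟_ xs)))
  (unique-set-length
    (SetoidUnique.map⁺ setoid (≡.setoid _) inj (DecSetoidUnique.deduplicate-! S xs)) ys!
    (mk⇔ (λ t∈ → let x , _ , t≡ = ∈-map⁻ f t∈ in Equivalence.from ys-values (x , sym t≡))
         (λ t∈ → values (Equivalence.to ys-values t∈))))
  where
  open DecSetoid S using (setoid; _≟_; _≈_) renaming (sym to ≈-sym; trans to ≈-trans)
  values : ∀ {t} → (∃ λ x → f x ≡ t) → t ∈ map f (deduplicate _≟_ xs)
  -- Deduplication keeps some element equivalent to `x`, perhaps not `x` itself; `cong-f` shows that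
  -- its value is the same.
  values (x , refl) = map⁺ (Any.map cong-f (SetoidMembership.∈-deduplicate⁺ setoid _≟_
    (λ z≈y x≈y → ≈-trans x≈y (≈-sym z≈y)) (E x)))

elements : Subset n → List (Fin n)
elements []            = []
elements (inside ∷ p)  = zero ∷ map suc (elements p)
elements (outside ∷ p) = map suc (elements p)

length-elements : (p : Subset n) → length (elements p) ≡ ∣ p ∣
length-elements []            = refl
length-elements (inside ∷ p)  = cong suc (trans (length-map Fin.suc (elements p)) (length-elements p))
length-elements (outside ∷ p) = trans (length-map Fin.suc (elements p)) (length-elements p)

elements-unique : (p : Subset n) → Unique (elements p)
elements-unique []            = []
elements-unique (inside ∷ p)  =
  All.map⁺ (All.tabulate λ _ ()) ∷ Unique.map⁺ Fin.suc-injective (elements-unique p)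
elements-unique (outside ∷ p) = Unique.map⁺ Fin.suc-injective (elements-unique p)

∈-elements⁺ : ∀ {p : Subset n} {x} → x ∈ˢ p → x ∈ elements p
∈-elements⁺ {p = inside ∷ p}  here       = here refl
∈-elements⁺ {p = inside ∷ p}  (there x∈) = there (∈-map⁺ suc (∈-elements⁺ x∈))
∈-elements⁺ {p = outside ∷ p} (there x∈) = ∈-map⁺ suc (∈-elements⁺ x∈)

∈-elements⁻ : ∀ (p : Subset n) {x} → x ∈ elements p → x ∈ˢ p
∈-elements⁻ (inside ∷ p)  (here refl) = here
∈-elements⁻ (inside ∷ p)  (there x∈)  with y , y∈ , refl ← ∈-map⁻ suc x∈ = there (∈-elements⁻ p y∈)
∈-elements⁻ (outside ∷ p) x∈          with y , y∈ , refl ← ∈-map⁻ suc x∈ = there (∈-elements⁻ p y∈)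

length-listing : ∀ {xs} (p : Subset n) → Unique xs → (∀ x → x ∈ xs ⇔ x ∈ˢ p) → length xs ≡ ∣ p ∣
length-listing p xs! xs∼p = trans
  (unique-set-length xs! (elements-unique p)
    (mk⇔ (∈-elements⁺ ∘ Equivalence.to (xs∼p _)) (Equivalence.from (xs∼p _) ∘ ∈-elements⁻ p)))
  (length-elements p)

∈-comprehension : ∀ {P : Pred (Fin n) p} (P? : Decidable P) {w} → w ∈ˢ comprehension P? ⇔ P w
∈-comprehension {P = P} P? {w} = mk⇔ to (λ Pw →
    lookup⇒[]= w _ (trans (lookup∘tabulate _ w) (dec-true (P? w) Pw)))
  where
  to : w ∈ˢ comprehension P? → P w
  to w∈ with P? w | trans (sym (lookup∘tabulate (does ∘ P?) w)) ([]=⇒lookup w∈)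
  ... | yes Pw | _ = Pw

-- Both components of the type are counted in this form: stabiliser elements by their codes in
-- `Fin 6`, orbits by their labels in `Fin 3`.
card-subset : (S : DecSetoid a ℓ) → let open DecSetoid S in
  ∀ {xs} (E : IsEnumeration setoid xs) (f : Carrier → Fin n) →
  (∀ {x y} → x ≈ y → f x ≡ f y) → (∀ {x y} → f x ≡ f y → x ≈ y) →
  (q : Subset n) → (∀ {t} → t ∈ˢ q ⇔ ∃ λ x → f x ≡ t) → card S E ≡ ∣ q ∣
card-subset S E f cong-f inj q q-values = trans
  (card-invariant S E f cong-f inj (elements-unique q)
    (mk⇔ (Equivalence.to q-values ∘ ∈-elements⁻ q) (∈-elements⁺ ∘ Equivalence.from q-values)))
  (length-elements q)

∈-range : ∀ {m l} (c : Vec (Fin m) l) {t} → t ∈ˢ range c ⇔ ∃ λ k → Vec.lookup c k ≡ t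
∈-range c = ∈-comprehension λ t → Fin.any? λ k → Vec.lookup c k Fin.≟ t

-- Choice of indices, and the combinatorics of an edge in a face.

module _ (_≟_ : DecidableEquality A) (c : Fin (suc n) → A) where

  position : A → Fin (suc n)
  position x with Fin.any? (λ k → c k ≟ x)
  ... | yes (k , _) = k
  -- An arbitrary default; `lookup-position` speaks only of values that `c` attains.
  ... | no  _       = zero

  lookup-position : ∀ {x} → (∃ λ k → c k ≡ x) → c (position x) ≡ x
  lookup-position {x} k with Fin.any? (λ k → c k ≟ x)
  ... | yes (_ , k≡x) = k≡x
  ... | no  ∄k        = contradiction k ∄k

-- π⁶ = 1, so going around the cycle of k gives the reverse inclusion.
perm-invariant : ∀ i (O : Fin 3 → Subset n) → (∀ k → O (perm i k) ⊆ O k) → ∀ k → O (perm i k) ≡ O k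
perm-invariant i O shrinks k = ⊆-antisym (shrinks k)
  (subst (λ l → O l ⊆ O (π k)) (perm-order i k)
    (shrinks (π k) ∘ shrinks (π (π k)) ∘ shrinks (π (π (π k))) ∘ shrinks (π (π (π (π k))))
      ∘ shrinks (π (π (π (π (π k)))))))
  where π = perm i

-- If `u` and `v` differed, `e` ⊂ `e ∪ ⁅ u ⁆` ⊂ `F` would be a strict chain, with a cardinality
-- strictly between 2 and 3.
complement-of-edge : ∀ {e F : Subset n} → ∣ e ∣ ≡ 2 → ∣ F ∣ ≡ 3 → e ⊆ F →
  ∀ {u v} → u ∈ˢ F → v ∈ˢ F → u ∉ˢ e → v ∉ˢ e → u ≡ v
complement-of-edge {e = e} {F} ∣e∣≡2 ∣F∣≡3 e⊆F {u} {v} u∈F v∈F u∉e v∉e with u Fin.≟ v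
... | yes u≡v = u≡v
... | no  u≢v = contradiction
  (ℕ.<-≤-trans (s≤s (p⊂q⇒∣p∣<∣q∣ e⊂e∪u)) (p⊂q⇒∣p∣<∣q∣ e∪u⊂F))
  (subst₂ (λ k l → ¬ (suc k < l)) (sym ∣e∣≡2) (sym ∣F∣≡3) (ℕ.<-irrefl refl))
  where
  e⊂e∪u : e ⊂ e ∪ ⁅ u ⁆
  e⊂e∪u = p⊆p∪q ⁅ u ⁆ , u , x∈p∪q⁺ (inj₂ (x∈⁅x⁆ u)) , u∉e
  e∪u⊂F : e ∪ ⁅ u ⁆ ⊂ F
  e∪u⊂F = e∪u⊆F , v , v∈F , v∉e∪u
    where
    e∪u⊆F : e ∪ ⁅ u ⁆ ⊆ F
    e∪u⊆F x∈ with x∈p∪q⁻ e ⁅ u ⁆ x∈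
    ... | inj₁ x∈e = e⊆F x∈e
    ... | inj₂ x∈u = subst (_∈ˢ F) (sym (x∈⁅y⁆⇒x≡y u x∈u)) u∈F
    v∉e∪u : v ∉ˢ e ∪ ⁅ u ⁆
    v∉e∪u v∈ with x∈p∪q⁻ e ⁅ u ⁆ v∈
    ... | inj₁ v∈e = v∉e v∈e
    ... | inj₂ v∈u = u≢v (sym (x∈⁅y⁆⇒x≡y u v∈u))

-- To be applied to three faces through one edge, of which `p` and `q` are the only two.
remaining-of-two : ∀ {A : Set a} {x y z p q : A} → x ≢ y → x ≢ z →
  x ≡ p ⊎ x ≡ q → y ≡ p ⊎ y ≡ q → z ≡ p ⊎ z ≡ q → y ≡ z
remaining-of-two x≢y x≢z (inj₁ refl) (inj₁ refl) _           = contradiction refl x≢y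
remaining-of-two x≢y x≢z (inj₁ refl) (inj₂ refl) (inj₁ refl) = contradiction refl x≢z
remaining-of-two x≢y x≢z (inj₁ refl) (inj₂ refl) (inj₂ refl) = refl
remaining-of-two x≢y x≢z (inj₂ refl) (inj₂ refl) _           = contradiction refl x≢y
remaining-of-two x≢y x≢z (inj₂ refl) (inj₁ refl) (inj₂ refl) = contradiction refl x≢z
remaining-of-two x≢y x≢z (inj₂ refl) (inj₁ refl) (inj₁ refl) = refl

lookup-injective : ∀ {xs : List A} → Unique xs → ∀ {i j} → List.lookup xs i ≡ List.lookup xs j → i ≡ j
lookup-injective (_ ∷ _)    {zero}  {zero}  _  = refl
lookup-injective (x∉ ∷ _)   {zero}  {suc j} eq = contradiction eq (All.lookup x∉ (∈-lookup j))
lookup-injective (x∉ ∷ _)   {suc i} {zero}  eq = contradiction (sym eq) (All.lookup x∉ (∈-lookup i))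
lookup-injective (_ ∷ xs!)  {suc i} {suc j} eq = cong suc (lookup-injective xs! eq)

module _ (X : SimplicialSurface n) where
  open SimplicialSurface X
  open Automorphism using (mapsFaces)

  -- Images of simplices under maps of the vertices.

  point-injective : ∀ {v w : Vertex} → point v ≡ point w → v ≡ w
  point-injective {v , p} {.v , q} refl = cong (v ,_) (T-irrelevant p q)

  ∈-image : ∀ (g : Vertex → Vertex) F {w} → w ∈ˢ image X g F ⇔ ∃ λ v → point v ∈ˢ F × point (g v) ≡ w
  ∈-image g F = ∈-comprehension {P = λ w → ∃ λ v → point v ∈ˢ F × point (g v) ≡ w} λ w →
    ∃Vertex? X λ v → (point v ∈ˢ? F) ×-dec (point (g v) Fin.≟ w)

  ∈-image⁺ : ∀ (g : Vertex → Vertex) F {v} → point v ∈ˢ F → point (g v) ∈ˢ image X g F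
  ∈-image⁺ g F {v} v∈F = Equivalence.from (∈-image g F) (v , v∈F , refl)

  ∈-image⁻ : ∀ (g : Vertex → Vertex) F {w} → point w ∈ˢ image X g F → ∃ λ v → point v ∈ˢ F × g v ≡ w
  ∈-image⁻ g F w∈ with v , v∈F , gv≡w ← Equivalence.to (∈-image g F) w∈ = v , v∈F , point-injective gv≡w

  image-mono : ∀ (g : Vertex → Vertex) {F G} → F ⊆ G → image X g F ⊆ image X g G
  image-mono g {F} {G} F⊆G w∈ with v , v∈F , refl ← Equivalence.to (∈-image g F) w∈ = ∈-image⁺ g G (F⊆G v∈F)

  image-agree : ∀ {g h : Vertex → Vertex} F → (∀ v → point v ∈ˢ F → g v ≡ h v) → image X g F ≡ image X h F
  image-agree {g} {h} F g≗h = ⊆-antisym (half g≗h) (half λ v v∈F → sym (g≗h v v∈F))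
    where
    half : ∀ {g h} → (∀ v → point v ∈ˢ F → g v ≡ h v) → image X g F ⊆ image X h F
    half {g} {h} g≗h w∈ with v , v∈F , refl ← Equivalence.to (∈-image g F) w∈ =
      subst (λ u → point u ∈ˢ image X h F) (sym (g≗h v v∈F)) (∈-image⁺ h F v∈F)

  image-∘ : ∀ (g h : Vertex → Vertex) F → image X (g ∘ h) F ≡ image X g (image X h F)
  image-∘ g h F = ⊆-antisym ⊆₁ ⊆₂
    where
    ⊆₁ : image X (g ∘ h) F ⊆ image X g (image X h F)
    ⊆₁ w∈ with v , v∈F , refl ← Equivalence.to (∈-image (g ∘ h) F) w∈ =
      ∈-image⁺ g (image X h F) (∈-image⁺ h F v∈F)
    ⊆₂ : image X g (image X h F) ⊆ image X (g ∘ h) F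
    ⊆₂ w∈ with u , u∈ , refl ← Equivalence.to (∈-image g (image X h F)) w∈
      with v , v∈F , refl ← ∈-image⁻ h F {u} u∈ = ∈-image⁺ (g ∘ h) F v∈F

  simplex-vertex : ∀ {F x} → IsSimplex F → x ∈ˢ F → IsSimplex ⁅ x ⁆
  simplex-vertex {F} {x} simplex x∈F =
    downClosed (λ y∈ → subst (_∈ˢ F) (sym (x∈⁅y⁆⇒x≡y x y∈)) x∈F) simplex

  -- An image records only those points of a set that are vertices; all points of a simplex are, so
  -- it can be recovered from its image.
  image-injective : ∀ {g : Vertex → Vertex} → (∀ {v w} → g v ≡ g w → v ≡ w) →
    ∀ {F G} → IsSimplex F → IsSimplex G → image X g F ≡ image X g G → F ≡ G
  image-injective {g} inj F-simplex G-simplex gF≡gG =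
    ⊆-antisym (half F-simplex gF≡gG) (half G-simplex (sym gF≡gG))
    where
    half : ∀ {F G} → IsSimplex F → image X g F ≡ image X g G → F ⊆ G
    half {F} {G} F-simplex gF≡gG {x} x∈F =
      let v = x , simplex-vertex F-simplex x∈F
          w , w∈G , gw≡gv = ∈-image⁻ g G {g v} (subst (point (g v) ∈ˢ_) gF≡gG (∈-image⁺ g F x∈F))
      in subst (λ u → point u ∈ˢ G) (inj gw≡gv) w∈G

  vertexList : Subset n → List Vertex
  vertexList F = filter (λ v → point v ∈ˢ? F) (deduplicate (_≟ᵛ_ X) (vertices X))

  ∈-vertexList : ∀ F v → v ∈ vertexList F ⇔ point v ∈ˢ F
  ∈-vertexList F v = mk⇔ (proj₂ ∘ ∈-filter⁻ in-F? {xs = deduplicate (_≟ᵛ_ X) (vertices X)})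
                       (∈-filter⁺ in-F? (∈-deduplicate⁺ (_≟ᵛ_ X) (∈-vertices X v)))
    where
    in-F? : Decidable λ v → point v ∈ˢ F
    in-F? v = point v ∈ˢ? F

  vertexList-unique : ∀ F → Unique (vertexList F)
  vertexList-unique F = Unique.filter⁺ _ (DecUnique.deduplicate-! (_≟ᵛ_ X) (vertices X))

  length-vertexList : ∀ {F} → IsSimplex F → length (vertexList F) ≡ ∣ F ∣
  length-vertexList {F} simplex = trans (sym (length-map point (vertexList F)))
    (length-listing F (Unique.map⁺ point-injective (vertexList-unique F)) (λ x → mk⇔
      (λ x∈ → let v , v∈ , x≡ = ∈-map⁻ point x∈ in
        subst (_∈ˢ F) (sym x≡) (Equivalence.to (∈-vertexList F v) v∈))
      (λ x∈F → ∈-map⁺ point (Equivalence.from (∈-vertexList F (x , simplex-vertex simplex x∈F)) x∈F))))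

  -- Injectivity makes the images of the listed vertices of `F` a listing of the image without
  -- repetition.
  ∣image∣ : ∀ {g : Vertex → Vertex} → (∀ {v w} → g v ≡ g w → v ≡ w) →
    ∀ {F} → IsSimplex F → ∣ image X g F ∣ ≡ ∣ F ∣
  ∣image∣ {g} inj {F} simplex = trans (sym (length-listing (image X g F)
    (Unique.map⁺ (inj ∘ point-injective) (vertexList-unique F)) (λ x → mk⇔
      (λ x∈ → let v , v∈ , x≡ = ∈-map⁻ (point ∘ g) x∈ in
        subst (_∈ˢ image X g F) (sym x≡) (∈-image⁺ g F (Equivalence.to (∈-vertexList F v) v∈)))
      (λ x∈ → let v , v∈F , gv≡x = Equivalence.to (∈-image g F) x∈ in
        subst (_∈ map (point ∘ g) (vertexList F)) gv≡x
          (∈-map⁺ (point ∘ g) (Equivalence.from (∈-vertexList F v) v∈F))))))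
    (trans (length-map (point ∘ g) (vertexList F)) (length-vertexList simplex))

  -- Rigidity: an automorphism is determined by its values on one face.

  apply-injective : ∀ (g : Automorphism X) {v w} → apply g v ≡ apply g w → v ≡ w
  apply-injective g {v} {w} gv≡gw =
    trans (sym (strictlyInverseʳ v)) (trans (cong from gv≡gw) (strictlyInverseʳ w))
    where open Inverse (Automorphism.permutation g) using (from; strictlyInverseʳ)

  AgreeOn : (g h : Automorphism X) → Subset n → Set
  AgreeOn g h F = ∀ v → point v ∈ˢ F → apply g v ≡ apply h v

  -- The edge g(e) lies in g(F) = h(F), in g(G) and in h(G). Both g(G) and h(G) differ from g(F),
  -- and only two faces contain the edge, so they coincide.
  neighbour-image : ∀ {g h} (F G : Face) → ShareEdge F G → proj₁ F ≢ proj₁ G → AgreeOn g h (proj₁ F) →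
    image X (apply g) (proj₁ G) ≡ image X (apply h) (proj₁ G)
  neighbour-image {g} {h} (F , F-face) (G , G-face) (e , (e-simplex , ∣e∣≡2) , e⊆F , e⊆G) F≢G g≗h
    -- The image of `e` is an edge: it is a simplex as a subset of the face g(F), and injectivity
    -- keeps its size 2.
    with _ , _ , _ , _ , _ , either ← edge-in-two-faces {image X (apply g) e}
           ( downClosed (image-mono (apply g) e⊆F) (proj₁ (mapsFaces g F F-face))
           , trans (∣image∣ (apply-injective g) e-simplex) ∣e∣≡2 )
    = remaining-of-two
        (F≢G ∘ image-injective (apply-injective g) (proj₁ F-face) (proj₁ G-face))
        (F≢G ∘ image-injective (apply-injective h) (proj₁ F-face) (proj₁ G-face)
             ∘ trans (sym (image-agree F g≗h)))
        (either (mapsFaces g F F-face) (image-mono (apply g) e⊆F))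
        (either (mapsFaces g G G-face) (image-mono (apply g) e⊆G))
        (either (mapsFaces h G G-face)
          (subst (_⊆ image X (apply h) G) (sym (image-agree e λ w w∈e → g≗h w (e⊆F w∈e)))
            (image-mono (apply h) e⊆G)))

  agree-shareEdge : ∀ {g h} (F G : Face) → ShareEdge F G → AgreeOn g h (proj₁ F) → AgreeOn g h (proj₁ G)
  agree-shareEdge {g} {h} F∙@(F , _) G∙@(G , _ , ∣G∣≡3) shared@(e , (_ , ∣e∣≡2) , e⊆F , e⊆G) g≗h v v∈G =
    byCases (F ≟ˢ G) (point v ∈ˢ? e)
    where
    outside-e : F ≢ G → point v ∉ˢ e → apply g v ≡ apply h v
    outside-e F≢G v∉e =
      let gv∈hG = subst (point (apply g v) ∈ˢ_) (neighbour-image {g} {h} F∙ G∙ shared F≢G g≗h)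
                    (∈-image⁺ (apply g) G v∈G)
          u , u∈G , hu≡gv = ∈-image⁻ (apply h) G {apply g v} gv∈hG
          -- On `e` the two maps agree, so `u` in `e` would give g(u) = h(u) = g(v), hence `u` =
          -- `v`, although `v` is off `e`.
          u∉e u∈e = v∉e (subst (λ w → point w ∈ˢ e)
                      (apply-injective g (trans (g≗h u (e⊆F u∈e)) hu≡gv)) u∈e)
          u≡v = point-injective (complement-of-edge ∣e∣≡2 ∣G∣≡3 e⊆G u∈G v∈G u∉e v∉e)
      in trans (sym hu≡gv) (cong (apply h) u≡v)

    byCases : Dec (F ≡ G) → Dec (point v ∈ˢ e) → apply g v ≡ apply h v
    byCases (yes F≡G) _         = g≗h v (subst (point v ∈ˢ_) (sym F≡G) v∈G)
    byCases (no _)    (yes v∈e) = g≗h v (e⊆F v∈e)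
    byCases (no F≢G)  (no v∉e)  = outside-e F≢G v∉e

  face-at : ∀ v → ∃ λ F → IsFace F × point v ∈ˢ F
  face-at v = F zero , F-face zero
    where open Umbrella (umbrella v)

  rigid : ∀ {g h F} → IsFace F → AgreeOn g h F → ∀ v → apply g v ≡ apply h v
  rigid {g} {h} {F} F-face g≗h v with G , G-face , v∈G ← face-at v =
    along (connected (F , F-face) (G , G-face)) g≗h v v∈G
    where
    along : ∀ {F G : Face} → Star ShareEdge F G → AgreeOn g h (proj₁ F) → AgreeOn g h (proj₁ G)
    along ε                       = λ g≗h → g≗h
    along (_◅_ {F} {G} F∼G G∼*H) = along G∼*H ∘ agree-shareEdge {g} {h} F G F∼G

  -- Numbering the corners of a simplex.

  -- The size is a separate parameter so that the numbering can be transported along equations of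
  -- sizes, finally to `Fin 3` for a face.
  record Enumeration (F : Subset n) (m : ℕ) : Set where
    field
      corner           : Fin m → Vertex
      corner-injective : ∀ {k l} → corner k ≡ corner l → k ≡ l
      corner-∈         : ∀ k → point (corner k) ∈ˢ F
      corner-onto      : ∀ {v} → point v ∈ˢ F → ∃ λ k → corner k ≡ v

  enumerate : ∀ {F} → IsSimplex F → Enumeration F ∣ F ∣
  enumerate {F} simplex = subst (Enumeration F) (length-vertexList simplex) record
    { corner           = List.lookup (vertexList F)
    ; corner-injective = lookup-injective (vertexList-unique F)
    ; corner-∈         = λ k → Equivalence.to (∈-vertexList F _) (∈-lookup k)
    ; corner-onto      = λ {v} v∈F → let v∈ = Equivalence.from (∈-vertexList F v) v∈F in
                           Any.index v∈ , sym (lookup-index v∈)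
    }

  image-id : ∀ {F} → IsSimplex F → image X id F ≡ F
  image-id {F} simplex = ⊆-antisym ⊆₁ ⊆₂
    where
    ⊆₁ : image X id F ⊆ F
    ⊆₁ w∈ with v , v∈F , refl ← Equivalence.to (∈-image id F) w∈ = v∈F
    ⊆₂ : F ⊆ image X id F
    ⊆₂ {x} x∈F = ∈-image⁺ id F {x , simplex-vertex simplex x∈F} x∈F

  -- Composition of automorphisms and orbits of vertices.

  identity : Automorphism X
  identity = automorphism (↔-id Vertex) λ F F-face →
    subst IsFace (sym (image-id (proj₁ F-face))) F-face

  infixr 9 _∙_
  _∙_ : Automorphism X → Automorphism X → Automorphism X
  g ∙ h = automorphism (Automorphism.permutation g ↔-∘ Automorphism.permutation h) λ F F-face →
    subst IsFace (sym (image-∘ (apply g) (apply h) F)) (mapsFaces g _ (mapsFaces h F F-face))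

  image-∙ : ∀ g h {F G H} → image X (apply g) G ≡ H → image X (apply h) F ≡ G →
            image X (apply (g ∙ h)) F ≡ H
  image-∙ g h {F} gG≡H hF≡G =
    trans (image-∘ (apply g) (apply h) F) (trans (cong (image X (apply g)) hF≡G) gG≡H)

  -- The decision procedure repeats the one local to `orbit`, so that both comprehensions are the
  -- same by definition.
  ∈-orbit : ∀ v {w} → w ∈ˢ orbit X v ⇔ ∃ λ (g : Automorphism X) → point (apply g v) ≡ w
  ∈-orbit v = ∈-comprehension {P = λ w → ∃ λ (g : Automorphism X) → point (apply g v) ≡ w} λ w →
    map′ Any.satisfied
      (λ (g , gv≡w) → Any.map (λ g≗h → trans (cong point (sym (g≗h v))) gv≡w) (automorphisms-complete X g))
      (Any.any? (λ g → point (apply g v) Fin.≟ w) (automorphisms X))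

  -- Composition with `g` gives this inclusion; for elements of a face stabiliser, `perm-invariant`
  -- upgrades it to an equality of corner orbits.
  orbit-apply-⊆ : ∀ g v → orbit X (apply g v) ⊆ orbit X v
  orbit-apply-⊆ g v w∈ = let h , hgv≡w = Equivalence.to (∈-orbit (apply g v)) w∈ in
    Equivalence.from (∈-orbit v) (h ∙ g , hgv≡w)

  -- The stabiliser of a face as a subgroup of S₃.

  module _ {F : Subset n} (F-face : IsFace F) where
    open Enumeration (subst (Enumeration F) (proj₂ F-face) (enumerate (proj₁ F-face)))

    stabiliser-perm : (s : Stabiliser X F) → ∃ λ i → ∀ k → apply (proj₁ s) (corner k) ≡ corner (perm i k)
    stabiliser-perm (g , gF≡F) =
      -- The corners are sent to three distinct corners, numbered by `σ`, so this triple occurs in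
      -- the table.
      let i , i≗σ = perm-onto (σ 0F) (σ 1F) (σ 2F) (distinct λ ()) (distinct λ ()) (distinct λ ())
      in i , λ k → sym (trans (cong corner (trans (i≗σ k) (lookup∘tabulate σ k))) (corner-σ k))
      where
      σ-spec : ∀ k → ∃ λ l → corner l ≡ apply g (corner k)
      σ-spec k = corner-onto (subst (point (apply g (corner k)) ∈ˢ_) gF≡F
                   (∈-image⁺ (apply g) F (corner-∈ k)))
      σ : Fin 3 → Fin 3
      σ = proj₁ ∘ σ-spec
      corner-σ : ∀ k → corner (σ k) ≡ apply g (corner k)
      corner-σ = proj₂ ∘ σ-spec
      distinct : ∀ {k l} → k ≢ l → σ k ≢ σ l
      distinct {k} {l} k≢l σk≡σl = k≢l (corner-injective (apply-injective g
        (trans (sym (corner-σ k)) (trans (cong corner σk≡σl) (corner-σ l)))))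

    code : Stabiliser X F → Fin 6
    code = proj₁ ∘ stabiliser-perm

    apply-corner : ∀ s k → apply (proj₁ s) (corner k) ≡ corner (perm (code s) k)
    apply-corner = proj₂ ∘ stabiliser-perm

    code-unique : ∀ {s i} → (∀ k → apply (proj₁ s) (corner k) ≡ corner (perm i k)) → code s ≡ i
    code-unique {s} {i} s≗i = perm-faithful (code s) i λ k →
      corner-injective (trans (sym (apply-corner s k)) (s≗i k))

    code-cong : ∀ {s t : Stabiliser X F} →
      (∀ v → apply (proj₁ s) v ≡ apply (proj₁ t) v) → code s ≡ code t
    code-cong {s} {t} s≗t = code-unique {s} λ k → trans (s≗t (corner k)) (apply-corner t k)

    corners-agree : ∀ g h → (∀ k → apply g (corner k) ≡ apply h (corner k)) → AgreeOn g h F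
    corners-agree g h g≗h v v∈F = let k , k≡v = corner-onto {v} v∈F in
      subst (λ w → apply g w ≡ apply h w) k≡v (g≗h k)

    -- Equal codes mean agreement at the corners, hence on `F`, hence everywhere by `rigid`. This is
    -- what makes the stabiliser as large as its set of codes.
    code-injective : ∀ {s t : Stabiliser X F} → code s ≡ code t →
      ∀ v → apply (proj₁ s) v ≡ apply (proj₁ t) v
    code-injective {s} {t} s≡t = rigid {proj₁ s} {proj₁ t} F-face (corners-agree (proj₁ s) (proj₁ t) λ k →
      trans (apply-corner s k) (trans (cong (λ i → corner (perm i k)) s≡t) (sym (apply-corner t k))))

    -- The stabiliser of F as a subgroup of S₃.
    codes : Subset 6
    codes = comprehension λ i → Any.any? (λ s → code s Fin.≟ i) (stabiliserElements X F)

    ∈-codes : ∀ {i} → i ∈ˢ codes ⇔ ∃ λ s → code s ≡ i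
    ∈-codes {i} = mk⇔ (Any.satisfied ∘ Equivalence.to member) (Equivalence.from member ∘ listed)
      where
      member = ∈-comprehension λ i → Any.any? (λ s → code s Fin.≟ i) (stabiliserElements X F)
      listed : (∃ λ s → code s ≡ i) → Any (λ s → code s ≡ i) (stabiliserElements X F)
      listed (s , s≡i) = Any.map (λ {t} s≈t → trans (sym (code-cong {s} {t} s≈t)) s≡i)
        (stabiliserElements-complete X F s)

    codes-submonoid : IsSubmonoid codes
    -- The first row of `symmetries` is the identity, so the identity automorphism has code `zero`.
    codes-submonoid = Equivalence.from ∈-codes (s₀ , code-unique {s₀} λ k → cong corner (sym (perm-identity k))) ,
      λ i i∈ j j∈ l l≗ij → closed (Equivalence.to ∈-codes i∈) (Equivalence.to ∈-codes j∈) l≗ij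
      where
      s₀ : Stabiliser X F
      s₀ = identity , image-id (proj₁ F-face)
      closed : ∀ {i j l} → (∃ λ s → code s ≡ i) → (∃ λ s → code s ≡ j) →
               (∀ k → perm l k ≡ perm i (perm j k)) → l ∈ˢ codes
      closed (s@(g , gF≡F) , refl) (t@(h , hF≡F) , refl) l≗ij = Equivalence.from ∈-codes
        ( st , code-unique {st} λ k → trans (cong (apply g) (apply-corner t k))
            (trans (apply-corner s (perm (code t) k)) (cong corner (sym (l≗ij k)))))
        where
        st : Stabiliser X F
        st = g ∙ h , image-∙ g h gF≡F hF≡F

    card-stabiliser : card (stabiliser X F) (stabiliserElements-complete X F) ≡ ∣ codes ∣
    card-stabiliser = card-subset (stabiliser X F) (stabiliserElements-complete X F) code
      (λ {s} {t} → code-cong {s} {t}) (λ {s} {t} → code-injective {s} {t}) codes ∈-codes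

    -- Orbits of vertices as a colouring of the corners.

    cornerOrbit : Fin 3 → Subset n
    cornerOrbit = orbit X ∘ corner

    orbit-perm : ∀ s k → cornerOrbit (perm (code s) k) ≡ cornerOrbit k
    orbit-perm s = perm-invariant (code s) cornerOrbit λ k →
      subst (λ v → orbit X v ⊆ cornerOrbit k) (apply-corner s k) (orbit-apply-⊆ (proj₁ s) (corner k))

    -- Names an orbit by the number of a corner in it. The choice depends only on the orbit, so
    -- corners in one orbit get one colour.
    label : Subset n → Fin 3
    label = position _≟ˢ_ cornerOrbit

    cornerOrbit-label : ∀ {o} → (∃ λ k → cornerOrbit k ≡ o) → cornerOrbit (label o) ≡ o
    cornerOrbit-label = lookup-position _≟ˢ_ cornerOrbit

    labels : Vec (Fin 3) 3
    labels = Vec.tabulate (label ∘ cornerOrbit)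

    lookup-labels : ∀ k → Vec.lookup labels k ≡ label (cornerOrbit k)
    lookup-labels = lookup∘tabulate (label ∘ cornerOrbit)

    labels-invariant : IsInvariant codes labels
    labels-invariant i i∈ k = let s , s≡i = Equivalence.to ∈-codes i∈ in
      trans (lookup-labels (perm i k))
        (trans (cong label (subst (λ i → cornerOrbit (perm i k) ≡ cornerOrbit k) s≡i (orbit-perm s k)))
          (sym (lookup-labels k)))

    module _ (transitive : FaceTransitive X) where

      -- If g maps F to a face at v and h maps that face back to F, then h ∙ g stabilises F,
      -- so orbit v lies between two equal corner orbits; this needs no inverse of g.
      cornerOrbit-onto : ∀ v → ∃ λ k → cornerOrbit k ≡ orbit X v
      cornerOrbit-onto v =
        let G , G-face , v∈G = face-at v
            g , gF≡G = transitive F G F-face G-face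
            h , hG≡F = transitive G F G-face F-face
            u , u∈F , gu≡v = ∈-image⁻ (apply g) F {v} (subst (point v ∈ˢ_) (sym gF≡G) v∈G)
            k , k≡u = corner-onto u∈F
            gk≡v = trans (cong (apply g) k≡u) gu≡v
            s = h ∙ g , image-∙ h g hG≡F gF≡G
            k~hv = trans (sym (orbit-perm s k)) (cong (orbit X)
                     (trans (sym (apply-corner s k)) (cong (apply h) gk≡v)))
        in k , ⊆-antisym
          (subst (_⊆ orbit X v) (sym k~hv) (orbit-apply-⊆ h v))
          (subst (λ w → orbit X w ⊆ cornerOrbit k) gk≡v (orbit-apply-⊆ g (corner k)))

      -- By transitivity every orbit is a corner orbit, so its label determines it and labels count
      -- orbits.
      label-injective : ∀ {v w} → label (orbit X v) ≡ label (orbit X w) → orbit X v ≡ orbit X w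
      label-injective {v} {w} v≡w = trans (sym (cornerOrbit-label (cornerOrbit-onto v)))
        (trans (cong cornerOrbit v≡w) (cornerOrbit-label (cornerOrbit-onto w)))

      ∈-range-labels : ∀ {t} → t ∈ˢ range labels ⇔ ∃ λ v → label (orbit X v) ≡ t
      ∈-range-labels {t} = mk⇔ to from
        where
        to : t ∈ˢ range labels → ∃ λ v → label (orbit X v) ≡ t
        to t∈ = let k , k≡t = Equivalence.to (∈-range labels) t∈ in
          corner k , trans (sym (lookup-labels k)) k≡t
        from : (∃ λ v → label (orbit X v) ≡ t) → t ∈ˢ range labels
        from (v , v≡t) = let k , k~v = cornerOrbit-onto v in
          Equivalence.from (∈-range labels) (k , trans (lookup-labels k) (trans (cong label k~v) v≡t))

      card-orbits : card (orbits X) (vertices-complete X) ≡ ∣ range labels ∣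
      card-orbits = card-subset (orbits X) (vertices-complete X) (λ v → label (orbit X v))
        (λ {v} {w} v~w → cong label {orbit X v} {orbit X w} v~w)
        (λ {v} {w} → label-injective {v} {w}) (range labels) ∈-range-labels

theorem3p8 : ∀ {n : ℕ} (X : SimplicialSurface n) → FaceTransitive X →
    ∀ (F : Subset n) → SimplicialSurface.IsFace X F →
    vf X F ∈ (3 , 1) ∷ (2 , 1) ∷ (2 , 2) ∷ (1 , 1) ∷ (1 , 2) ∷ (1 , 3) ∷ (1 , 6) ∷ []
theorem3p8 X transitive F F-face = subst₂ (λ a s → (a , s) ∈ types)
  (sym (card-orbits X F-face transitive)) (sym (card-stabiliser X F-face))
  (triangle-types (codes X F-face) (codes-submonoid X F-face)
    (labels X F-face) (labels-invariant X F-face))
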